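{- A join space is projective if and only if it is dense and join-equivalence-relational.
   Context: A join space is a set $X$ with a ternary relation $\langle\cdot,\cdot,\cdot\rangle$ on $X$ such that: $\langle a,x,x\rangle$ for all $a,x\in X$; $\langle x,b,y\rangle$ implies $\langle y,b,x\rangle$ for all $x,b,y\in X$; and $\langle x,y,x\rangle$ implies $y=x$ for all $x,y\in X$. For $a,c\in X$ put $ac:=\{x\in X\mid\langle a,x,c\rangle\}$. For $A\subseteq X$ and $x,y\in X$, $\langle A,x,y\rangle$ means that there is $a\in A$ with $\langle a,x,y\rangle$. For $A\subseteq X$: $X$ is $A$-transitive iff the binary relation $\langle A,\cdot,\cdot\rangle$ is transitive on $X$. $X$ is $A$-symmetric iff the binary relation $\langle A,\cdot,\cdot\rangle$ is symmetric on $X\setminus A$. $X$ is $A$-equivalence-relational iff it is $A$-transitive and $A$-symmetric. $X$ is equivalence-relational iff it is $\{a\}$-equivalence-relational for every $a\in X$. $X$ is join-equivalence-relational iff for all $a,b\in X$ it is $ab$-equivalence-relational. $X$ is preprojective iff it is equivalence-relational and for all $a,b,c,d\in X$: if $b=c$ or $a=d$ or $bc\cap ad\neq\emptyset$, then $a=b$ or $c=d$ or $ab\cap cd\neq\emptyset$. $X$ is dense iff for all $a,b\in X$ with $a\neq b$, $ab\setminus\{a,b\}\neq\emptyset$. $X$ is projective iff it is preprojective and dense. -}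

module Defs where

open import Data.Product using (_×_; ∃-syntax)
open import Data.Sum using (_⊎_)
open import Level using (Level; _⊔_; suc)
open import Relation.Binary.Core using (Rel)
open import Relation.Binary.Definitions using (Transitive)
open import Relation.Binary.PropositionalEquality using (_≡_; _≢_)
open import Relation.Unary using (Pred; _∈_; _∉_; _∪_; _∖_; _≬_; ｛_｝; Satisfiable)

record JoinSpace (c ℓ : Level) : Set (suc (c ⊔ ℓ)) where
  field
    Carrier   : Set c
    ⟨_,_,_⟩   : Carrier → Carrier → Carrier → Set ℓ
    endpoint  : ∀ a x → ⟨ a , x , x ⟩
    symmetric : ∀ {x b y} → ⟨ x , b , y ⟩ → ⟨ y , b , x ⟩
    antisym   : ∀ {x y} → ⟨ x , y , x ⟩ → y ≡ x

  join : Carrier → Carrier → Pred Carrier ℓ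
  join a c x = ⟨ a , x , c ⟩

  ⟨_,·,·⟩ : ∀ {p} → Pred Carrier p → Rel Carrier (c ⊔ ℓ ⊔ p)
  ⟨ A ,·,·⟩ x y = ∃[ a ] (a ∈ A × ⟨ a , x , y ⟩)

module _ {c ℓ : Level} (X : JoinSpace c ℓ) where
  open JoinSpace X

  IsTransitiveFor : ∀ {p} → Pred Carrier p → Set (c ⊔ ℓ ⊔ p)
  IsTransitiveFor A = Transitive ⟨ A ,·,·⟩

  IsSymmetricFor : ∀ {p} → Pred Carrier p → Set (c ⊔ ℓ ⊔ p)
  IsSymmetricFor A = ∀ {x y} → x ∉ A → y ∉ A → ⟨ A ,·,·⟩ x y → ⟨ A ,·,·⟩ y x

  IsEquivalenceRelationalFor : ∀ {p} → Pred Carrier p → Set (c ⊔ ℓ ⊔ p)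
  IsEquivalenceRelationalFor A = IsTransitiveFor A × IsSymmetricFor A

  EquivalenceRelational : Set (c ⊔ ℓ)
  EquivalenceRelational = ∀ a → IsEquivalenceRelationalFor ｛ a ｝

  JoinEquivalenceRelational : Set (c ⊔ ℓ)
  JoinEquivalenceRelational = ∀ a b → IsEquivalenceRelationalFor (join a b)

  -- P ≬ Q says that some element lies in both P and Q, i.e. P ∩ Q ≠ ∅.
  Preprojective : Set (c ⊔ ℓ)
  Preprojective =
    EquivalenceRelational ×
    (∀ a b c d → b ≡ c ⊎ a ≡ d ⊎ join b c ≬ join a d
               → a ≡ b ⊎ c ≡ d ⊎ join a b ≬ join c d)

  Dense : Set (c ⊔ ℓ)
  Dense = ∀ a b → a ≢ b → Satisfiable (join a b ∖ (｛ a ｝ ∪ ｛ b ｝))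

  Projective : Set (c ⊔ ℓ)
  Projective = Preprojective × Dense

{-# OPTIONS --safe #-}
-- The relation ⟨ ab ,·,·⟩ compares points by lines through ab.  Its transitivity
-- on x, y, z, with x ∈ py and y ∈ qz for p, q ∈ ab, is Pasch's axiom for the triangle
-- on p, q, y: the lines pq and zx meet, and they do so inside the convex set ab.
-- Conversely, if x ∈ bc ∩ ad, then x relates to both a and b over cd, so a
-- relates to b, which means that ab meets cd.
module Submission where

open import Axiom.ExcludedMiddle using (ExcludedMiddle)
open import Data.Empty using (⊥-elim)
open import Data.Product using (_×_; _,_)
open import Data.Sum using (_⊎_; inj₁; inj₂)
open import Function.Base using (_∘_)
open import Function.Bundles using (_⇔_; mk⇔)
open import Level using (Level; _⊔_; Lift; lift; lower)
open import Relation.Binary.Definitions using (DecidableEquality)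
open import Relation.Binary.PropositionalEquality using (_≡_; _≢_; refl; sym; ≢-sym)
open import Relation.Nullary using (Dec; yes; no)
import Relation.Nullary.Decidable as Dec
open import Relation.Unary using (_∈_; _∉_; _≬_)
open import Defs

module _ {c ℓ : Level} (X : JoinSpace c ℓ) where
  open JoinSpace X

  startpoint : ∀ a x → ⟨ a , a , x ⟩
  startpoint a x = symmetric (endpoint x a)

  -- By `antisym`, the join of `a` with itself is the singleton of `a`.
  joinEquivalenceRelational⇒equivalenceRelational :
    JoinEquivalenceRelational X → EquivalenceRelational X
  joinEquivalenceRelational⇒equivalenceRelational jer a with jer a a
  ... | trans-aa , sym-aa =
      (λ p q → fromJoin (trans-aa (toJoin p) (toJoin q)))
    , (λ x∉ y∉ p → fromJoin (sym-aa (x∉ ∘ sym ∘ antisym) (y∉ ∘ sym ∘ antisym) (toJoin p)))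
    where
    toJoin : ∀ {x y} → ⟨ (a ≡_) ,·,·⟩ x y → ⟨ join a a ,·,·⟩ x y
    toJoin (_ , refl , axy) = a , endpoint a a , axy

    fromJoin : ∀ {x y} → ⟨ join a a ,·,·⟩ x y → ⟨ (a ≡_) ,·,·⟩ x y
    fromJoin (p , p∈aa , pxy) = p , sym (antisym p∈aa) , pxy

module _ {c ℓ : Level} (em : ExcludedMiddle (c ⊔ ℓ)) (X : JoinSpace c ℓ)
         (er : EquivalenceRelational X) where
  open JoinSpace X

  private
    _≟_ : DecidableEquality Carrier
    x ≟ y = Dec.map′ lower lift (em {Lift ℓ (x ≡ y)})

    _∈join?_,_ : ∀ x a b → Dec (x ∈ join a b)
    x ∈join? a , b = Dec.map′ lower lift (em {Lift c (x ∈ join a b)})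

  pointTransitive : ∀ {a x y z} → ⟨ a , x , y ⟩ → ⟨ a , y , z ⟩ → ⟨ a , x , z ⟩
  pointTransitive {a} axy ayz with er a
  ... | trans-a , _ with trans-a (a , refl , axy) (a , refl , ayz)
  ... | _ , refl , axz = axz

  pointSymmetric : ∀ {a x y} → a ≢ x → a ≢ y → ⟨ a , x , y ⟩ → ⟨ a , y , x ⟩
  pointSymmetric {a} a≢x a≢y axy with er a
  ... | _ , sym-a with sym-a a≢x a≢y (a , refl , axy)
  ... | _ , refl , ayx = ayx

  -- Seen from `a`, the points `p` and `b` are equivalent, so `b` may be replaced by `p`. Here
  -- `a ≢ b`, since otherwise `p` would equal `a`.
  exchange : ∀ {a p b q} → a ≢ p → p ∈ join a b → q ∈ join a b → q ∈ join a p
  exchange {a} {p} {b} a≢p apb aqb with a ≟ b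
  ... | yes refl = ⊥-elim (a≢p (sym (antisym apb)))
  ... | no a≢b = pointTransitive aqb (pointSymmetric a≢p a≢b apb)

  join-convex : ∀ {a b p q r} → p ∈ join a b → q ∈ join a b → r ∈ join p q → r ∈ join a b
  join-convex {a} {p = p} apb aqb prq with a ≟ p
  ... | yes refl = pointTransitive prq aqb
  -- Transitivity over `p` first puts `r` in the join of `a` and `p`; transitivity over `a` then
  -- carries it to that of `a` and `b`.
  ... | no a≢p = pointTransitive (symmetric (pointTransitive prq pqa)) apb
    where pqa = symmetric (exchange a≢p apb aqb)

  preprojective⇒joinEquivalenceRelational : Preprojective X → JoinEquivalenceRelational X
  preprojective⇒joinEquivalenceRelational (_ , pasch) a b = transitive-ab , symmetric-ab
    where
    ∈⇒≢ : ∀ {p x} → p ∈ join a b → x ∉ join a b → p ≢ x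
    ∈⇒≢ p∈ x∉ refl = x∉ p∈

    symmetric-ab : IsSymmetricFor X (join a b)
    symmetric-ab x∉ y∉ (p , p∈ , pxy) =
      p , p∈ , pointSymmetric (∈⇒≢ p∈ x∉) (∈⇒≢ p∈ y∉) pxy

    transitive-ab : IsTransitiveFor X (join a b)
    transitive-ab {x} {y} {z} (p , p∈ , pxy) (q , q∈ , qyz) with x ∈join? a , b
    ... | yes x∈ = x , x∈ , startpoint X x z
    ... | no x∉ = meet (pasch p q z x (inj₂ (inj₂ (y , qyz , pyx))))
      where
      -- By convexity, being outside the join passes from `x` to `y` and on to `z`. Hence points of
      -- the join differ from all three, as `pointSymmetric` requires.
      y∉ : y ∉ join a b
      y∉ y∈ = x∉ (join-convex p∈ y∈ pxy)

      z∉ : z ∉ join a b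
      z∉ z∈ = y∉ (join-convex q∈ z∈ qyz)

      pyx : ⟨ p , y , x ⟩
      pyx = pointSymmetric (∈⇒≢ p∈ x∉) (∈⇒≢ p∈ y∉) pxy

      meet : p ≡ q ⊎ z ≡ x ⊎ join p q ≬ join z x → ⟨ join a b ,·,·⟩ x z
      meet (inj₁ refl) = p , p∈ , pointTransitive pxy qyz
      meet (inj₂ (inj₁ refl)) = p , p∈ , endpoint p x
      meet (inj₂ (inj₂ (r , prq , zrx))) with z ≟ x
      ... | yes refl = p , p∈ , endpoint p x
      ... | no z≢x =
        -- Over `z`, the points `r` and `x` are interchangeable, because `z` differs from both.
        r , r∈ , symmetric (pointSymmetric (≢-sym (∈⇒≢ r∈ z∉)) z≢x zrx)
        where r∈ = join-convex p∈ q∈ prq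

  joinEquivalenceRelational⇒preprojective : JoinEquivalenceRelational X → Preprojective X
  joinEquivalenceRelational⇒preprojective jer = er , pasch
    where
    pasch : ∀ a b c d → b ≡ c ⊎ a ≡ d ⊎ join b c ≬ join a d
                      → a ≡ b ⊎ c ≡ d ⊎ join a b ≬ join c d
    pasch a b _ d (inj₁ refl) = inj₂ (inj₂ (b , endpoint a b , startpoint X b d))
    pasch a b c _ (inj₂ (inj₁ refl)) = inj₂ (inj₂ (a , startpoint X a b , endpoint c a))
    pasch a b c d (inj₂ (inj₂ (x , bxc , axd))) with a ≟ b
    ... | yes a≡b = inj₁ a≡b
    ... | no a≢b with c ≟ d
    ... | yes c≡d = inj₂ (inj₁ c≡d)
    -- If `a` or `b` lies in `join c d`, it is itself the meeting point. Otherwise both lie outside,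
    -- where the relation over `join c d` is symmetric.
    ... | no c≢d with a ∈join? c , d
    ... | yes a∈ = inj₂ (inj₂ (a , startpoint X a b , a∈))
    ... | no a∉ with b ∈join? c , d
    ... | yes b∈ = inj₂ (inj₂ (b , endpoint a b , b∈))
    ... | no b∉ with jer c d
    ... | trans-cd , sym-cd = inj₂ (inj₂ (meet (trans-cd a~x x~b)))
      where
      c∈ : c ∈ join c d
      c∈ = startpoint X c d

      d∈ : d ∈ join c d
      d∈ = endpoint c d

      ∉⇒≢ : ∀ {y p} → y ∉ join c d → p ∈ join c d → p ≢ y
      ∉⇒≢ y∉ p∈ refl = y∉ p∈

      x~b : ⟨ join c d ,·,·⟩ x b
      x~b = c , c∈ , symmetric bxc

      x~a : ⟨ join c d ,·,·⟩ x a
      x~a = d , d∈ , symmetric axd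

      -- A point x of cd differs from c or from d, so cd contains b or a, respectively.
      x∉ : x ∉ join c d
      x∉ x∈ with d ≟ x
      ... | no d≢x =
        a∉ (join-convex d∈ x∈ (pointSymmetric d≢x (∉⇒≢ a∉ d∈) (symmetric axd)))
      ... | yes refl =
        b∉ (join-convex c∈ d∈ (pointSymmetric c≢d (∉⇒≢ b∉ c∈) (symmetric bxc)))

      a~x : ⟨ join c d ,·,·⟩ a x
      a~x = sym-cd x∉ a∉ x~a

      -- The witness `p` of the relation is the meeting point: over `b`, it changes places with `a`,
      -- being distinct from `b`, which lies outside `join c d`.
      meet : ⟨ join c d ,·,·⟩ a b → join a b ≬ join c d
      meet (p , p∈ , pab) =
        p , symmetric (pointSymmetric (≢-sym a≢b) (≢-sym (∉⇒≢ b∉ p∈)) (symmetric pab)) , p∈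

corollary5p3 : ∀ {c ℓ : Level} → ExcludedMiddle (c ⊔ ℓ) → (X : JoinSpace c ℓ) →
    Projective X ⇔ (Dense X × JoinEquivalenceRelational X)
corollary5p3 em X = mk⇔
  (λ { (pre@(er , _) , dense) → dense , preprojective⇒joinEquivalenceRelational em X er pre })
  (λ { (dense , jer) →
    joinEquivalenceRelational⇒preprojective em X
      (joinEquivalenceRelational⇒equivalenceRelational X jer) jer
    , dense })
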